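{- Let $\lambda$ be a nonnegative integer and let $G$ be a finite connected $\lambda$-edge-connected graph. Then either $G^2$ is maximally edge-connected, or \[ \lambda(G^2) \geq \frac{1}{2}\lambda^{3/2} - \frac{1}{2}\lambda. \]
   Context: All graphs are finite and simple. A graph is $\lambda$-edge-connected if it cannot be disconnected by removing fewer than $\lambda$ edges. The square $G^2$ of $G$ is the graph on $V(G)$ in which two distinct vertices are adjacent if and only if their distance in $G$ is at most $2$. $\lambda(H)$ denotes the edge-connectivity of $H$ (minimum number of edges whose removal disconnects $H$). A graph is maximally edge-connected if its edge-connectivity equals its minimum degree. -}

module Defs where

open import Data.Bool using (Bool; true; false; _∧_; _∨_; not)
open import Data.Nat using (ℕ; zero; suc; _+_; _*_; _≤_; _<ᵇ_)
open import Data.Fin using (Fin; toℕ; _≟_)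
open import Data.List using (List; length; filterᵇ; allFin; map)
open import Data.Nat.ListAction using (sum)
open import Data.Bool.ListAction using (any)
open import Data.Product using (Σ; _×_; _,_)
open import Data.Empty using (⊥)
open import Relation.Nullary using (¬_)
open import Relation.Nullary.Decidable using (⌊_⌋)
open import Relation.Binary.PropositionalEquality using (_≡_)

Adjacency : ℕ → Set
Adjacency n = Fin n → Fin n → Bool

record IsSimpleGraph {n : ℕ} (G : Adjacency n) : Set where
  field
    symmetric   : ∀ u v → G u v ≡ G v u
    irreflexive : ∀ v → G v v ≡ false

data Reachable {n : ℕ} (G : Adjacency n) : Fin n → Fin n → Set where
  here : ∀ {v} → Reachable G v v
  step : ∀ {u w v} → G u w ≡ true → Reachable G w v → Reachable G u v

Connected : {n : ℕ} → Adjacency n → Set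
Connected G = ∀ u v → Reachable G u v

degree : {n : ℕ} → Adjacency n → Fin n → ℕ
degree {n} G v = length (filterᵇ (G v) (allFin n))

IsMinDegree : {n : ℕ} → Adjacency n → ℕ → Set
IsMinDegree G d = (∀ v → d ≤ degree G v) × Σ _ (λ v → degree G v ≡ d)

removedEdges : {n : ℕ} → Adjacency n → Adjacency n → ℕ
removedEdges {n} G F =
  sum (map (λ u → length (filterᵇ (λ v → (toℕ u <ᵇ toℕ v) ∧ (G u v ∧ not (F u v))) (allFin n)))
           (allFin n))

IsSpanningSubgraph : {n : ℕ} → Adjacency n → Adjacency n → Set
IsSpanningSubgraph G F = IsSimpleGraph F × (∀ u v → F u v ≡ true → G u v ≡ true)

EdgeConnected : {n : ℕ} → ℕ → Adjacency n → Set
EdgeConnected k G = ∀ F → IsSpanningSubgraph G F → suc (removedEdges G F) ≤ k → Connected F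

-- λ(G) = k: G is k-edge-connected and (if G has at least two vertices)
-- G is not (k+1)-edge-connected; convention λ(K₁) = 0.
IsEdgeConnectivity : {n : ℕ} → Adjacency n → ℕ → Set
IsEdgeConnectivity {n} G k =
  EdgeConnected k G × (2 ≤ n → ¬ EdgeConnected (suc k) G) × (n ≤ 1 → k ≡ 0)

MaximallyEdgeConnected : {n : ℕ} → Adjacency n → Set
MaximallyEdgeConnected G = Σ ℕ (λ k → IsEdgeConnectivity G k × IsMinDegree G k)

square : {n : ℕ} → Adjacency n → Adjacency n
square {n} G u v = not ⌊ u ≟ v ⌋ ∧ (G u v ∨ any (λ w → G u w ∧ G w v) (allFin n))

{-# OPTIONS --safe #-}
module Submission where

-- Let (X, Y) be a minimum cut of G², of size μ, and suppose that all degrees of G² exceed μ. Call a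
-- vertex high if at least λ / 2 of its G-neighbours lie across the cut, and move every high vertex
-- to the other side. Some vertex on each side has no G²-neighbour across the cut, hence is not high,
-- so the new partition is still a cut of G and at least λ edges of G cross it. Both ends of each
-- such edge turn out to be incident with at least λ / 2 of the G²-edges between X and Y. With a and
-- b such vertices on the two new sides, λ ≤ ab and (a + b) λ / 2 ≤ 2 μ, so that
-- λ³ ≤ ab λ² ≤ (a + b)² λ² / 4 ≤ 4 μ².

open import Defs
open import Data.Nat as ℕ
  using (ℕ; zero; suc; _+_; _*_; _≤_; _<_; _<ᵇ_; _≤?_; _<?_; z≤n; s≤s; s≤s⁻¹)

open import Algebra.Properties.Semiring.Sum using ()
open import Data.Bool using (Bool; true; false; _∧_; _∨_; not; _xor_; if_then_else_)
import Data.Bool.Properties as Bool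
open import Data.Bool.ListAction using (any; or)
open import Data.Empty using (⊥; ⊥-elim)
open import Data.Fin using (Fin; zero; suc; toℕ; _≟_)
open import Data.Fin.Properties using (any?; toℕ-injective)
open import Data.Fin.Subset using (Subset)
open import Data.Fin.Subset.Properties using (anySubset?)
open import Data.List using (length; filterᵇ; allFin; map)
import Data.List as List
open import Data.List.Properties using (map-cong)
open import Data.List.Membership.Propositional using (lose)
open import Data.List.Membership.Propositional.Properties using (∈-allFin)
open import Data.List.Relation.Unary.Any.Properties using (any⁺)
import Data.Nat.ListAction as ListAction
open import Data.Nat.Induction using (<-rec)
open import Data.Nat.Properties hiding (_≟_)
open import Data.Nat.Tactic.RingSolver using (solve-∀)
open import Data.Product using (Σ; _×_; _,_; ∃; ∃-syntax; proj₁; proj₂)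
open import Data.Sum using (_⊎_; inj₁; inj₂)
open import Data.Vec using (lookup; tabulate)
open import Data.Vec.Properties using (lookup∘tabulate)
open import Function using (_∘_; id; Equivalence)
open import Relation.Binary using (tri<; tri≈; tri>)
open import Relation.Binary.PropositionalEquality
open import Relation.Nullary using (¬_; Dec; yes; no; contradiction; _×-dec_)
open import Relation.Nullary.Decidable using (⌊_⌋; dec-true; dec-false; isYes≗does)

open Algebra.Properties.Semiring.Sum +-*-semiring
  using (sum; sum-cong-≗; ∑-distrib-+; ∑-comm; *-distribˡ-sum; *-distribʳ-sum; sum-replicate-zero)

private variable
  n : ℕ

-- Booleans, indicators and finite sums

true≢false : {b : Bool} → b ≡ true → ¬ b ≡ false
true≢false refl ()

⌊⌋-true : {A : Set} (a? : Dec A) → A → ⌊ a? ⌋ ≡ true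
⌊⌋-true a? a = trans (isYes≗does a?) (dec-true a? a)

⌊⌋-false : {A : Set} (a? : Dec A) → ¬ A → ⌊ a? ⌋ ≡ false
⌊⌋-false a? ¬a = trans (isYes≗does a?) (dec-false a? ¬a)

𝟙 : Bool → ℕ
𝟙 b = if b then 1 else 0

𝟙-mono : ∀ {a b} → (a ≡ true → b ≡ true) → 𝟙 a ≤ 𝟙 b
𝟙-mono {false} {b} f = z≤n
𝟙-mono {true}  {b} f rewrite f refl = ≤-refl

∧-true : ∀ {a b} → a ≡ true → b ≡ true → a ∧ b ≡ true
∧-true refl refl = refl

∧-true⁻ : ∀ {a b} → a ∧ b ≡ true → a ≡ true × b ≡ true
∧-true⁻ {true} {true} refl = refl , refl

sum-mono-≤ : {f g : Fin n → ℕ} → (∀ i → f i ≤ g i) → sum f ≤ sum g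
sum-mono-≤ {zero}  h = z≤n
sum-mono-≤ {suc n} h = +-mono-≤ (h zero) (sum-mono-≤ (h ∘ suc))

sum-mono-< : {f g : Fin n → ℕ} → (∀ i → f i ≤ g i) → ∀ i → f i < g i → sum f < sum g
sum-mono-< {suc n} h zero    p = +-mono-<-≤ p (sum-mono-≤ (h ∘ suc))
sum-mono-< {suc n} h (suc i) p = +-mono-≤-< (h zero) (sum-mono-< (h ∘ suc) i p)

sum-zero : {f : Fin n → ℕ} → (∀ i → f i ≡ 0) → sum f ≡ 0
sum-zero {n} h = trans (sum-cong-≗ h) (sum-replicate-zero n)

sum-point : (i : Fin n) (f : Fin n → ℕ) → sum (λ j → 𝟙 ⌊ j ≟ i ⌋ * f j) ≡ f i
sum-point {suc n} zero    f =
  trans (cong₂ _+_ (+-identityʳ (f zero)) (sum-zero {n} λ _ → refl)) (+-identityʳ (f zero))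
sum-point {suc n} (suc i) f = trans (sum-cong-≗ {n} shift) (sum-point i (f ∘ suc))
  where
  shift : ∀ j → 𝟙 ⌊ suc j ≟ suc i ⌋ * f (suc j) ≡ 𝟙 ⌊ j ≟ i ⌋ * f (suc j)
  shift j with j ≟ i
  ... | yes _ = refl
  ... | no _  = refl

length-filterᵇ-tabulate : {A : Set} (p : A → Bool) (f : Fin n → A) →
  length (filterᵇ p (List.tabulate f)) ≡ sum (𝟙 ∘ p ∘ f)
length-filterᵇ-tabulate {zero}  p f = refl
length-filterᵇ-tabulate {suc n} p f with p (f zero)
... | true  = cong suc (length-filterᵇ-tabulate p (f ∘ suc))
... | false = length-filterᵇ-tabulate p (f ∘ suc)

sum-map-tabulate : {A : Set} (g : A → ℕ) (f : Fin n → A) →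
  ListAction.sum (map g (List.tabulate f)) ≡ sum (g ∘ f)
sum-map-tabulate {zero}  g f = refl
sum-map-tabulate {suc n} g f = cong (g (f zero) +_) (sum-map-tabulate g (f ∘ suc))

degree-sum : (G : Adjacency n) (v : Fin n) → degree G v ≡ sum (𝟙 ∘ G v)
degree-sum G v = length-filterᵇ-tabulate (G v) id

-- Counting edges through ordered pairs

arcs : Adjacency n → ℕ
arcs {n} D = sum λ u → sum λ v → 𝟙 (D u v)

arcs-mono : {D E : Adjacency n} → (∀ u v → D u v ≡ true → E u v ≡ true) → arcs D ≤ arcs E
arcs-mono h = sum-mono-≤ λ u → sum-mono-≤ λ v → 𝟙-mono (h u v)

arcs-cong : {D E : Adjacency n} → (∀ u v → D u v ≡ E u v) → arcs D ≡ arcs E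
arcs-cong h = sum-cong-≗ λ u → sum-cong-≗ λ v → cong 𝟙 (h u v)

2*-+ : ∀ m → 2 * m ≡ m + m
2*-+ = solve-∀

-- `arcs` counts both orientations of an edge, `removedEdges` only the increasing one. Comparing the
-- two ends puts each arc in exactly one of `A u v` and `A v u`; irreflexivity empties the diagonal.
arcs-removedEdges : {G F : Adjacency n} → IsSimpleGraph G → IsSimpleGraph F →
  arcs (λ u v → G u v ∧ not (F u v)) ≡ 2 * removedEdges G F
arcs-removedEdges {n} {G} {F} simpleG simpleF = begin
  arcs D                                               ≡⟨ sum-cong-≗ (λ u → sum-cong-≗ (split u)) ⟩
  sum (λ u → sum λ v → A u v + A v u)                  ≡⟨ sum-cong-≗ (λ u → ∑-distrib-+ (A u) (λ v → A v u)) ⟩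
  sum (λ u → sum (A u) + sum (λ v → A v u))            ≡⟨ ∑-distrib-+ (sum ∘ A) (λ u → sum λ v → A v u) ⟩
  sum (sum ∘ A) + sum (λ u → sum λ v → A v u)          ≡⟨ cong (sum (sum ∘ A) +_) (∑-comm (λ u v → A v u)) ⟩
  sum (sum ∘ A) + sum (sum ∘ A)                        ≡⟨ 2*-+ (sum (sum ∘ A)) ⟨
  2 * sum (sum ∘ A)                                    ≡⟨ cong (2 *_) removed ⟨
  2 * removedEdges G F                                 ∎
  where
  open ≡-Reasoning
  open IsSimpleGraph
  D : Adjacency n
  D u v = G u v ∧ not (F u v)
  A : Fin n → Fin n → ℕ
  A u v = 𝟙 ((toℕ u <ᵇ toℕ v) ∧ D u v)
  removed : removedEdges G F ≡ sum (sum ∘ A)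
  removed = trans (sum-map-tabulate {n} _ id)
    (sum-cong-≗ λ u → length-filterᵇ-tabulate (λ v → (toℕ u <ᵇ toℕ v) ∧ D u v) id)
  split : ∀ u v → 𝟙 (D u v) ≡ A u v + A v u
  split u v rewrite symmetric simpleG v u | symmetric simpleF v u with <-cmp (toℕ u) (toℕ v)
  ... | tri< p _ q rewrite dec-true (toℕ u <? toℕ v) p | dec-false (toℕ v <? toℕ u) q =
        sym (+-identityʳ _)
  ... | tri> p _ q rewrite dec-true (toℕ v <? toℕ u) q | dec-false (toℕ u <? toℕ v) p = refl
  ... | tri≈ _ u≡v _ with refl ← toℕ-injective u≡v rewrite irreflexive simpleG u
          | Bool.∧-zeroʳ (toℕ u <ᵇ toℕ u) = refl

-- Cuts and edge-connectedness

Nonconstant : (Fin n → Bool) → Set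
Nonconstant s = (∃[ x ] s x ≡ true) × (∃[ y ] s y ≡ false)

cross : Adjacency n → (Fin n → Bool) → Adjacency n
cross G s u v = G u v ∧ (s u xor s v)

-- The spanning subgraph left after deleting a cut, so that `removedEdges G (uncut G s)` is the size
-- of the cut `s`.
uncut : Adjacency n → (Fin n → Bool) → Adjacency n
uncut G s u v = G u v ∧ not (s u xor s v)

uncut-spanning : {G : Adjacency n} → IsSimpleGraph G → ∀ s → IsSpanningSubgraph G (uncut G s)
uncut-spanning simple s =
  record
    { symmetric   = λ u v → cong₂ (λ a b → a ∧ not b) (symmetric u v) (Bool.xor-comm (s u) (s v))
    ; irreflexive = λ v → cong (_∧ not (s v xor s v)) (irreflexive v)
    } , λ u v → proj₁ ∘ ∧-true⁻
  where open IsSimpleGraph simple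

arcs-cross : {G : Adjacency n} → IsSimpleGraph G → ∀ s →
  arcs (cross G s) ≡ 2 * removedEdges G (uncut G s)
arcs-cross {G = G} simple s =
  trans (arcs-cong λ u v → cut (G u v) (s u xor s v))
        (arcs-removedEdges simple (proj₁ (uncut-spanning simple s)))
  where
  cut : ∀ g x → g ∧ x ≡ g ∧ not (g ∧ not x)
  cut true  x = sym (Bool.not-involutive x)
  cut false x = refl

uncut-side : (G : Adjacency n) (s : Fin n → Bool) →
  ∀ {u v} → Reachable (uncut G s) u v → s u ≡ s v
uncut-side G s here = refl
uncut-side G s (step {u} {w} e r) =
  trans (same (s u) (s w) (proj₂ (∧-true⁻ {G u w} e))) (uncut-side G s r)
  where
  same : ∀ a b → not (a xor b) ≡ true → a ≡ b
  same true  true  _ = refl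
  same false false _ = refl

uncut-disconnected : (G : Adjacency n) {s : Fin n → Bool} → Nonconstant s →
  ¬ Connected (uncut G s)
uncut-disconnected G {s} ((x , sx) , (y , sy)) conn =
  true≢false sx (trans (uncut-side G s (conn x y)) sy)

edgeConnected⇒cut : ∀ {k} {G : Adjacency n} → IsSimpleGraph G → EdgeConnected k G →
  ∀ {s} → Nonconstant s → k ≤ removedEdges G (uncut G s)
edgeConnected⇒cut {G = G} simple conn {s} nonconst =
  ≮⇒≥ λ lt → uncut-disconnected G nonconst (conn _ (uncut-spanning simple s) lt)

reachable-snoc : {G : Adjacency n} → ∀ {u v w} → Reachable G u v → G v w ≡ true → Reachable G u w
reachable-snoc here       e = step e here
reachable-snoc (step f r) e = step f (reachable-snoc r e)

-- The set s of vertices known to be reachable from u grows as long as some edge of F leaves it;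
-- when none does, all edges of G leaving s have been removed.
cut⇒edgeConnected : ∀ {k} {G : Adjacency n} → IsSimpleGraph G →
  (∀ s → Nonconstant s → k ≤ removedEdges G (uncut G s)) → EdgeConnected k G
cut⇒edgeConnected {n} {k} {G} simple cuts F (simpleF , _) few u v =
  grow (sum (𝟙 ∘ not ∘ start)) start ≤-refl start-u start-reach
  where
  start : Fin n → Bool
  start w = ⌊ w ≟ u ⌋
  start-u : start u ≡ true
  start-u = ⌊⌋-true (u ≟ u) refl
  start-reach : ∀ w → start w ≡ true → Reachable F u w
  start-reach w _ with w ≟ u
  start-reach w _  | yes refl = here
  start-reach w () | no _
  -- The fuel `m` bounds the number of vertices outside `s`; each newly reached vertex lowers that
  -- number.
  grow : ∀ m s → sum (𝟙 ∘ not ∘ s) ≤ m → s u ≡ true →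
         (∀ w → s w ≡ true → Reachable F u w) → Reachable F u v
  grow m s size su reach with s v in sv
  ... | true = reach v sv
  ... | false with any? (λ a → any? λ b →
                (s a Bool.≟ true) ×-dec (s b Bool.≟ false) ×-dec (F a b Bool.≟ true))
  ...   | no noEdge = contradiction few (≤⇒≯ (*-cancelˡ-≤ 2 (begin
            2 * k                               ≤⟨ *-monoʳ-≤ 2 (cuts s ((u , su) , (v , sv))) ⟩
            2 * removedEdges G (uncut G s)      ≡⟨ arcs-cross simple s ⟨
            arcs (cross G s)                    ≤⟨ arcs-mono removed ⟩
            arcs (λ a b → G a b ∧ not (F a b))  ≡⟨ arcs-removedEdges simple simpleF ⟩
            2 * removedEdges G F                ∎)))
          where
          open ≤-Reasoning
          removed : ∀ a b → cross G s a b ≡ true → G a b ∧ not (F a b) ≡ true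
          kept : ∀ a b f → F a b ≡ f → ∀ p → s a ≡ p → ∀ q → s b ≡ q → p xor q ≡ true → not f ≡ true
          kept a b false f _     _ _     _ _ = refl
          kept a b true  f true  p false q _ = ⊥-elim (noEdge (a , b , p , q , f))
          kept a b true  f false p true  q _ =
            ⊥-elim (noEdge (b , a , q , p , trans (IsSimpleGraph.symmetric simpleF b a) f))
          removed a b e with Gab , x ← ∧-true⁻ {G a b} e =
            ∧-true Gab (kept a b (F a b) refl (s a) refl (s b) refl x)
  grow zero s size su reach | false | yes (a , b , sa , sb , Fab) =
    contradiction size (<⇒≱ (≤-<-trans z≤n
      (sum-mono-< {f = λ _ → 0} (λ _ → z≤n) b (subst (λ x → 0 < 𝟙 (not x)) (sym sb) (s≤s z≤n)))))
  grow (suc m) s size su reach | false | yes (a , b , sa , sb , Fab) =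
    grow m s′ (s≤s⁻¹ (≤-trans smaller size)) (cong (_∨ ⌊ u ≟ b ⌋) su) reach′
    where
    s′ : Fin n → Bool
    s′ w = s w ∨ ⌊ w ≟ b ⌋
    s′b : s′ b ≡ true
    s′b = trans (cong (s b ∨_) (⌊⌋-true (b ≟ b) refl)) (Bool.∨-zeroʳ (s b))
    shrink : ∀ x y → 𝟙 (not (x ∨ y)) ≤ 𝟙 (not x)
    shrink true  y     = z≤n
    shrink false true  = z≤n
    shrink false false = ≤-refl
    smaller : sum (𝟙 ∘ not ∘ s′) < sum (𝟙 ∘ not ∘ s)
    smaller = sum-mono-< (λ w → shrink (s w) ⌊ w ≟ b ⌋) b
      (subst₂ (λ x y → 𝟙 (not x) < 𝟙 (not y)) (sym s′b) (sym sb) (s≤s z≤n))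
    reach′ : ∀ w → s′ w ≡ true → Reachable F u w
    reach′ w e with s w in sw | w ≟ b
    reach′ w e  | true  | _        = reach w sw
    reach′ w e  | false | yes refl = reachable-snoc (reach a sa) Fab
    reach′ w () | false | no _

-- Minimum cuts and edge-connectivity

argmin : {P : Subset n → Set} → (∀ S → Dec (P S)) → (f : Subset n → ℕ) → ∃ P →
  ∃[ S ] P S × (∀ T → P T → f S ≤ f T)
argmin {P = P} P? f (S₀ , p₀) = <-rec Q search (f S₀) S₀ refl p₀
  where
  Q : ℕ → Set
  Q m = ∀ S → f S ≡ m → P S → ∃[ S ] P S × (∀ T → P T → f S ≤ f T)
  search : ∀ m → (∀ {k} → k < m → Q k) → Q m
  search m rec S refl p with anySubset? (λ T → P? T ×-dec (f T <? f S))
  ... | yes (T , q , lt) = rec lt T refl q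
  ... | no none          = S , p , λ T q → ≮⇒≥ λ lt → none (T , q , lt)

nonconstant? : (s : Fin n → Bool) → Dec (Nonconstant s)
nonconstant? s = any? (λ x → s x Bool.≟ true) ×-dec any? (λ y → s y Bool.≟ false)

-- A function and the vector tabulating it agree only pointwise; this carries a minimum found over
-- `Subset n` over to all functions `Fin n → Bool`.
removedEdges-uncut-cong : {G : Adjacency n} → IsSimpleGraph G → ∀ {s t} → (∀ v → s v ≡ t v) →
  removedEdges G (uncut G s) ≡ removedEdges G (uncut G t)
removedEdges-uncut-cong {G = G} simple {s} {t} s≗t = *-cancelˡ-≡ _ _ 2
  (trans (sym (arcs-cross simple s))
    (trans (arcs-cong λ u v → cong₂ (λ a b → G u v ∧ (a xor b)) (s≗t u) (s≗t v))
      (arcs-cross simple t)))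

nonconstant-tabulate : {s : Fin n → Bool} → Nonconstant s → Nonconstant (lookup (tabulate s))
nonconstant-tabulate {s = s} ((x , sx) , (y , sy)) =
  (x , trans (lookup∘tabulate s x) sx) , (y , trans (lookup∘tabulate s y) sy)

minimumCut : {G : Adjacency n} → IsSimpleGraph G → {s : Fin n → Bool} → Nonconstant s →
  ∃[ s ] Nonconstant s ×
    (∀ t → Nonconstant t → removedEdges G (uncut G s) ≤ removedEdges G (uncut G t))
minimumCut {G = G} simple {s} nonconst
  with S , p , minimal ← argmin (nonconstant? ∘ lookup)
         (λ S → removedEdges G (uncut G (lookup S))) (tabulate s , nonconstant-tabulate nonconst) =
  lookup S , p , λ t q → ≤-trans (minimal (tabulate t) (nonconstant-tabulate q))
    (≤-reflexive (removedEdges-uncut-cong simple (lookup∘tabulate t)))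

-- Minimality bounds every cut from below, and deleting the edges of the cut `s` itself disconnects,
-- which refutes the next value.
edgeConnectivity : {G : Adjacency n} → IsSimpleGraph G → 2 ≤ n → {s : Fin n → Bool} → Nonconstant s →
  (∀ t → Nonconstant t → removedEdges G (uncut G s) ≤ removedEdges G (uncut G t)) →
  IsEdgeConnectivity G (removedEdges G (uncut G s))
edgeConnectivity {G = G} simple 2≤n {s} nonconst minimal =
  cut⇒edgeConnected simple minimal ,
  (λ _ conn → uncut-disconnected G nonconst (conn _ (uncut-spanning simple s) ≤-refl)) ,
  λ n≤1 → contradiction (≤-trans 2≤n n≤1) λ { (s≤s ()) }

-- Degrees across a cut

oppositeDegree : Adjacency n → (Fin n → Bool) → Bool → Fin n → ℕ
oppositeDegree G s b u = sum λ w → 𝟙 (G u w ∧ (b xor s w))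

-- The case where `b` is the side of `u` itself. The switching argument also counts the neighbours
-- of `u` opposite to another vertex, hence the free `b` in `oppositeDegree`.
crossDegree : Adjacency n → (Fin n → Bool) → Fin n → ℕ
crossDegree G s u = oppositeDegree G s (s u) u

oppositeDegree-split : (G : Adjacency n) (s : Fin n → Bool) → ∀ b u →
  oppositeDegree G s b u + oppositeDegree G s (not b) u ≡ degree G u
oppositeDegree-split G s b u = begin
  oppositeDegree G s b u + oppositeDegree G s (not b) u
    ≡⟨ ∑-distrib-+ (λ w → 𝟙 (G u w ∧ (b xor s w))) (λ w → 𝟙 (G u w ∧ (not b xor s w))) ⟨
  sum (λ w → 𝟙 (G u w ∧ (b xor s w)) + 𝟙 (G u w ∧ (not b xor s w)))
    ≡⟨ sum-cong-≗ (λ w → split (G u w) b (s w)) ⟩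
  sum (𝟙 ∘ G u)
    ≡⟨ degree-sum G u ⟨
  degree G u ∎
  where
  open ≡-Reasoning
  split : ∀ g a c → 𝟙 (g ∧ (a xor c)) + 𝟙 (g ∧ (not a xor c)) ≡ 𝟙 g
  split false _     _     = refl
  split true  true  true  = refl
  split true  true  false = refl
  split true  false true  = refl
  split true  false false = refl

side : (Fin n → Bool) → Bool → Fin n → ℕ
side s b u = 𝟙 (not (b xor s u))

-- Exactly one end of a cut edge lies on side `b`, so an arc across the cut is counted by exactly
-- one of `X u v` and `X v u`.
side-sum-double : {G : Adjacency n} → IsSimpleGraph G → ∀ s b →
  arcs (cross G s) ≡ 2 * sum (λ u → side s b u * oppositeDegree G s b u)
side-sum-double {n} {G} simple s b = begin
  arcs (cross G s)                             ≡⟨ sum-cong-≗ (λ u → sum-cong-≗ (split u)) ⟩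
  sum (λ u → sum λ v → X u v + X v u)          ≡⟨ sum-cong-≗ (λ u → ∑-distrib-+ (X u) (λ v → X v u)) ⟩
  sum (λ u → sum (X u) + sum (λ v → X v u))    ≡⟨ ∑-distrib-+ (sum ∘ X) (λ u → sum λ v → X v u) ⟩
  sum (sum ∘ X) + sum (λ u → sum λ v → X v u)  ≡⟨ cong (sum (sum ∘ X) +_) (∑-comm (λ u v → X v u)) ⟩
  sum (sum ∘ X) + sum (sum ∘ X)                ≡⟨ 2*-+ (sum (sum ∘ X)) ⟨
  2 * sum (sum ∘ X)                            ≡⟨ cong (2 *_) (sum-cong-≗ factor) ⟨
  2 * sum (λ u → side s b u * oppositeDegree G s b u) ∎
  where
  open ≡-Reasoning
  X : Fin n → Fin n → ℕ
  X u v = side s b u * 𝟙 (G u v ∧ (b xor s v))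
  factor : ∀ u → side s b u * oppositeDegree G s b u ≡ sum (X u)
  factor u = *-distribˡ-sum (side s b u) (λ v → 𝟙 (G u v ∧ (b xor s v)))
  bits : ∀ g b p q → 𝟙 (g ∧ (p xor q)) ≡
    𝟙 (not (b xor p)) * 𝟙 (g ∧ (b xor q)) + 𝟙 (not (b xor q)) * 𝟙 (g ∧ (b xor p))
  bits false b     p     q     = sym (cong₂ _+_ (*-zeroʳ (𝟙 (not (b xor p)))) (*-zeroʳ (𝟙 (not (b xor q)))))
  bits true  true  true  true  = refl
  bits true  true  true  false = refl
  bits true  true  false true  = refl
  bits true  true  false false = refl
  bits true  false true  true  = refl
  bits true  false true  false = refl
  bits true  false false true  = refl
  bits true  false false false = refl
  split : ∀ u v → 𝟙 (cross G s u v) ≡ X u v + X v u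
  split u v rewrite IsSimpleGraph.symmetric simple v u = bits (G u v) b (s u) (s v)

side-sum : {G : Adjacency n} → IsSimpleGraph G → ∀ s b →
  sum (λ u → side s b u * oppositeDegree G s b u) ≡ removedEdges G (uncut G s)
side-sum {G = G} simple s b =
  *-cancelˡ-≡ _ _ 2 (trans (sym (side-sum-double simple s b)) (arcs-cross simple s))

-- An instance of `side-sum` with a one-vertex side. It makes every degree an upper bound for the
-- minimum cut, both in a graph and in its square.
removedEdges-singleton : {G : Adjacency n} → IsSimpleGraph G → ∀ v →
  removedEdges G (uncut G λ w → ⌊ w ≟ v ⌋) ≡ degree G v
removedEdges-singleton {G = G} simple v = begin
  removedEdges G (uncut G s)                            ≡⟨ side-sum simple s true ⟨
  sum (λ u → side s true u * oppositeDegree G s true u) ≡⟨ sum-cong-≗ (λ u → cong (λ b → 𝟙 b * oppositeDegree G s true u) (Bool.not-involutive (s u))) ⟩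
  sum (λ u → 𝟙 ⌊ u ≟ v ⌋ * oppositeDegree G s true u)   ≡⟨ sum-point v (oppositeDegree G s true) ⟩
  oppositeDegree G s true v                             ≡⟨ sum-cong-≗ other ⟩
  sum (𝟙 ∘ G v)                                         ≡⟨ degree-sum G v ⟨
  degree G v                                            ∎
  where
  open ≡-Reasoning
  s = λ w → ⌊ w ≟ v ⌋
  other : ∀ w → 𝟙 (G v w ∧ not ⌊ w ≟ v ⌋) ≡ 𝟙 (G v w)
  other w with w ≟ v
  ... | yes refl rewrite IsSimpleGraph.irreflexive simple w = refl
  ... | no _ = cong 𝟙 (Bool.∧-identityʳ (G v w))

singleton-nonconstant : (v : Fin (suc (suc n))) → Nonconstant λ w → ⌊ w ≟ v ⌋
singleton-nonconstant zero    = (zero , refl) , (suc zero , refl)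
singleton-nonconstant (suc v) = (suc v , ⌊⌋-true (suc v ≟ suc v) refl) , (zero , refl)

-- The square of a graph

square-edge : (G : Adjacency n) → ∀ {u v} → u ≢ v → G u v ≡ true → square G u v ≡ true
square-edge G {u} {v} u≢v Guv rewrite ⌊⌋-false (u ≟ v) u≢v | Guv = refl

square-path : (G : Adjacency n) → ∀ {u w v} → u ≢ v → G u w ≡ true → G w v ≡ true → square G u v ≡ true
square-path {n} G {u} {w} {v} u≢v Guw Gwv rewrite ⌊⌋-false (u ≟ v) u≢v =
  trans (cong (G u v ∨_) (Equivalence.to Bool.T-≡ (any⁺ (λ w → G u w ∧ G w v)
          (lose (∈-allFin w) (Equivalence.from Bool.T-≡ (∧-true Guw Gwv))))))
        (Bool.∨-zeroʳ (G u v))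

square-simple : {G : Adjacency n} → IsSimpleGraph G → IsSimpleGraph (square G)
square-simple {n} {G} simple = record
  { symmetric = λ u v → cong₂ (λ e p → not e ∧ p) (≟-sym u v)
      (cong₂ _∨_ (symmetric u v) (cong or (map-cong (λ w →
        trans (Bool.∧-comm (G u w) (G w v)) (cong₂ _∧_ (symmetric w v) (symmetric u w))) (allFin n))))
  ; irreflexive = λ v → cong (λ e → not e ∧ (G v v ∨ any (λ w → G v w ∧ G w v) (allFin n)))
      (⌊⌋-true (v ≟ v) refl)
  }
  where
  open IsSimpleGraph simple
  ≟-sym : ∀ u v → ⌊ u ≟ v ⌋ ≡ ⌊ v ≟ u ⌋
  ≟-sym u v with u ≟ v
  ... | yes refl = sym (⌊⌋-true (u ≟ u) refl)
  ... | no u≢v   = sym (⌊⌋-false (v ≟ u) (u≢v ∘ sym))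

-- Cuts smaller than every degree

module _ {H : Adjacency n} (simple : IsSimpleGraph H) (s : Fin n → Bool) where
  private
    μ = removedEdges H (uncut H s)

  -- Otherwise the side b, of size k ≤ μ, would satisfy k (μ + 2) ≤ μ + k², because a vertex x of
  -- that side has at most k ∸ 1 of its at least μ + 1 neighbours there; this forces k = 0.
  vertexOffCut : (∀ v → μ < degree H v) → ∀ {b} → ∃ (λ x → s x ≡ b) →
    ∃[ x ] s x ≡ b × oppositeDegree H s b x ≡ 0
  vertexOffCut deg {b} (x₀ , sx₀)
    with any? (λ x → (s x Bool.≟ b) ×-dec (oppositeDegree H s b x ℕ.≟ 0))
  ... | yes found = found
  ... | no none   = ⊥-elim (impossible k μ 1≤k k≤μ kμ)
    where
    k = sum (side s b)
    c = oppositeDegree H s b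
    sideSum : sum (λ x → side s b x * c x) ≡ μ
    sideSum = side-sum simple s b
    side-self : ∀ {x} → s x ≡ b → side s b x ≡ 1
    side-self {x} refl = cong (𝟙 ∘ not) (Bool.xor-same (s x))
    side-other : ∀ x → ¬ s x ≡ b → side s b x ≡ 0
    side-other x ne = go b (s x) ne
      where
      go : ∀ b c → ¬ c ≡ b → 𝟙 (not (b xor c)) ≡ 0
      go true  true  ne = contradiction refl ne
      go true  false ne = refl
      go false true  ne = refl
      go false false ne = contradiction refl ne
    1≤k : 1 ≤ k
    1≤k = ≤-<-trans z≤n (sum-mono-< {f = λ _ → 0} (λ _ → z≤n) x₀
      (≤-reflexive (sym (side-self sx₀))))
    -- Each vertex of the side has a neighbour across the cut, since otherwise it would be the
    -- vertex sought.
    k≤μ : k ≤ μ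
    k≤μ = ≤-trans (sum-mono-≤ bound) (≤-reflexive sideSum)
      where
      bound : ∀ x → side s b x ≤ side s b x * c x
      bound x with s x Bool.≟ b
      ... | no ne rewrite side-other x ne = z≤n
      ... | yes eq rewrite side-self eq =
            ≤-trans (n≢0⇒n>0 λ z → none (x , eq , z)) (≤-reflexive (sym (*-identityˡ (c x))))
    inside : ∀ {x} → s x ≡ b → oppositeDegree H s (not b) x < k
    inside {x} sx = sum-mono-< (λ w → 𝟙-mono (into w)) x strict
      where
      into : ∀ w → H x w ∧ (not b xor s w) ≡ true → not (b xor s w) ≡ true
      into w e = trans (Bool.not-distribˡ-xor b (s w)) (proj₂ (∧-true⁻ {H x w} e))
      strict : 𝟙 (H x x ∧ (not b xor s x)) < side s b x
      strict rewrite IsSimpleGraph.irreflexive simple x | side-self sx = ≤-refl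
    -- The `2` collects two strict inequalities: the degree of `x` exceeds `μ`, and `x` counts
    -- towards `k` without being its own neighbour.
    bound : ∀ x → side s b x * (2 + μ) ≤ side s b x * c x + side s b x * k
    bound x with s x Bool.≟ b
    ... | no ne rewrite side-other x ne = z≤n
    ... | yes eq rewrite side-self eq = begin
      1 * (2 + μ)                                ≡⟨ *-identityˡ _ ⟩
      suc (suc μ)                                ≤⟨ s≤s (deg x) ⟩
      suc (degree H x)                           ≡⟨ cong suc (oppositeDegree-split H s b x) ⟨
      suc (c x + oppositeDegree H s (not b) x)   ≡⟨ +-suc (c x) _ ⟨
      c x + suc (oppositeDegree H s (not b) x)   ≤⟨ +-monoʳ-≤ (c x) (inside eq) ⟩
      c x + k                                    ≡⟨ cong₂ _+_ (*-identityˡ (c x)) (*-identityˡ k) ⟨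
      1 * c x + 1 * k                            ∎
      where open ≤-Reasoning
    kμ : k * (2 + μ) ≤ μ + k * k
    kμ = begin
      k * (2 + μ)                                          ≡⟨ *-distribʳ-sum (2 + μ) (side s b) ⟩
      sum (λ x → side s b x * (2 + μ))                     ≤⟨ sum-mono-≤ bound ⟩
      sum (λ x → side s b x * c x + side s b x * k)        ≡⟨ ∑-distrib-+ (λ x → side s b x * c x) (λ x → side s b x * k) ⟩
      sum (λ x → side s b x * c x) + sum (λ x → side s b x * k)
                                                           ≡⟨ cong₂ _+_ sideSum (sym (*-distribʳ-sum k (side s b))) ⟩
      μ + k * k                                            ∎
      where open ≤-Reasoning
    impossible : ∀ k μ → 1 ≤ k → k ≤ μ → k * (2 + μ) ≤ μ + k * k → ⊥
    -- With `k = 1 + i` and `μ = k + j`, the left side of `h` exceeds the right by `1 + i + i * j`.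
    impossible (suc i) μ _ k≤μ h with j , refl ← m≤n⇒∃[o]m+o≡n k≤μ =
      m+1+n≰m (suc i + j + suc i * suc i) (subst (_≤ suc i + j + suc i * suc i) (expand i j) h)
      where
      expand : ∀ i j → suc i * (2 + (suc i + j)) ≡ suc i + j + suc i * suc i + suc (i + i * j)
      expand = solve-∀

-- Arithmetic of the bound

4ab≤[a+b]² : ∀ a b → 4 * (a * b) ≤ (a + b) * (a + b)
4ab≤[a+b]² a b with ≤-total a b
-- In either order the defect of the inequality is the square of the difference `d`, which is a
-- natural number.
... | inj₁ a≤b with d , refl ← m≤n⇒∃[o]m+o≡n a≤b =
  ≤-trans (m≤m+n _ (d * d)) (≤-reflexive (identity a d))
  where
  identity : ∀ a d → 4 * (a * (a + d)) + d * d ≡ (a + (a + d)) * (a + (a + d))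
  identity = solve-∀
4ab≤[a+b]² a b | inj₂ b≤a with d , refl ← m≤n⇒∃[o]m+o≡n b≤a =
  ≤-trans (m≤m+n _ (d * d)) (≤-reflexive (identity b d))
  where
  identity : ∀ b d → 4 * ((b + d) * b) + d * d ≡ (b + d + b) * (b + d + b)
  identity = solve-∀

-- Multiplying by 4 clears the denominator of `ab ≤ (a + b)² / 4`. The bound `4 * μ` is twice the
-- sum of all cross degrees, which is `2 * μ`.
cube-bound : ∀ {l a b μ} → l ≤ a * b → (a + b) * l ≤ 4 * μ → l * l * l ≤ (2 * μ) * (2 * μ)
cube-bound {l} {a} {b} {μ} l≤ab [a+b]l≤4μ = *-cancelˡ-≤ 4 (begin
  4 * (l * l * l)                ≤⟨ *-monoʳ-≤ 4 (*-monoʳ-≤ (l * l) l≤ab) ⟩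
  4 * (l * l * (a * b))          ≡⟨ regroup l (a * b) ⟩
  4 * (a * b) * (l * l)          ≤⟨ *-monoˡ-≤ (l * l) (4ab≤[a+b]² a b) ⟩
  (a + b) * (a + b) * (l * l)    ≡⟨ square-product (a + b) l ⟩
  (a + b) * l * ((a + b) * l)    ≤⟨ *-mono-≤ [a+b]l≤4μ [a+b]l≤4μ ⟩
  4 * μ * (4 * μ)                ≡⟨ quarter μ ⟩
  4 * (2 * μ * (2 * μ))          ∎)
  where
  open ≤-Reasoning
  regroup : ∀ l p → 4 * (l * l * p) ≡ 4 * p * (l * l)
  regroup = solve-∀
  square-product : ∀ x l → x * x * (l * l) ≡ x * l * (x * l)
  square-product = solve-∀
  quarter : ∀ μ → 4 * μ * (4 * μ) ≡ 4 * (2 * μ * (2 * μ))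
  quarter = solve-∀

-- Switching the high vertices

module _ {G : Adjacency n} (simple : IsSimpleGraph G) (l : ℕ) (minDegree : ∀ v → l ≤ degree G v)
         (s : Fin n → Bool) where

  -- Doubling the degree expresses the threshold `l / 2` without rounding for odd `l`.
  High : Fin n → Set
  High u = l ≤ 2 * crossDegree G s u

  high? : ∀ u → Dec (High u)
  high? u = l ≤? 2 * crossDegree G s u

  switched : Fin n → Bool
  switched u = s u xor ⌊ high? u ⌋

  Good : Fin n → Set
  Good u = l ≤ 2 * crossDegree (square G) s u

  crossDegree-square : ∀ v → crossDegree G s v ≤ crossDegree (square G) s v
  crossDegree-square v = sum-mono-≤ λ w → 𝟙-mono (edge w)
    where
    edge : ∀ w → G v w ∧ (s v xor s w) ≡ true → square G v w ∧ (s v xor s w) ≡ true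
    edge w e with Gvw , x ← ∧-true⁻ {G v w} e =
      ∧-true (square-edge G (λ { refl → true≢false Gvw (IsSimpleGraph.irreflexive simple v) }) Gvw) x

  -- Neighbours of `u` are within distance 2 of `v` through `u`, and those opposite to `v` differ
  -- from `v` because they lie on another side.
  oppositeDegree-neighbour : ∀ {u v} → G u v ≡ true →
    oppositeDegree G s (s v) u ≤ crossDegree (square G) s v
  oppositeDegree-neighbour {u} {v} Guv = sum-mono-≤ λ w → 𝟙-mono (path w)
    where
    path : ∀ w → G u w ∧ (s v xor s w) ≡ true → square G v w ∧ (s v xor s w) ≡ true
    path w e with Guw , x ← ∧-true⁻ {G u w} e =
      ∧-true (square-path G (λ { refl → true≢false x (Bool.xor-same (s v)) })
               (trans (IsSimpleGraph.symmetric simple v u) Guv) Guw) x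

  -- Of at least `l` neighbours fewer than `l / 2` lie across the cut, so at least half of `l`
  -- remain on the side of `u`.
  low⇒oppositeDegree : ∀ u → ¬ High u → l ≤ 2 * oppositeDegree G s (not (s u)) u
  low⇒oppositeDegree u low = +-cancelˡ-≤ l l _ (begin
    l + l                                              ≡⟨ 2*-+ l ⟨
    2 * l                                              ≤⟨ *-monoʳ-≤ 2 (minDegree u) ⟩
    2 * degree G u                                     ≡⟨ cong (2 *_) (oppositeDegree-split G s (s u) u) ⟨
    2 * (crossDegree G s u + other)                    ≡⟨ *-distribˡ-+ 2 (crossDegree G s u) other ⟩
    2 * crossDegree G s u + 2 * other                  ≤⟨ +-monoˡ-≤ (2 * other) (<⇒≤ (≰⇒> low)) ⟩
    l + 2 * other                                      ∎)
    where
    open ≤-Reasoning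
    other = oppositeDegree G s (not (s u)) u

  -- If v is low, then u has at least l / 2 neighbours on the side opposite to v: its neighbours
  -- across s if u is high (then u and v share a side), those on its own side if u is low.
  switched-edge⇒good : ∀ {u v} → G u v ≡ true → switched u xor switched v ≡ true → Good v
  switched-edge⇒good {u} {v} Guv e with high? v | high? u
  ... | yes hv | _      = ≤-trans hv (*-monoʳ-≤ 2 (crossDegree-square v))
  ... | no _   | yes hu = ≤-trans hu (*-monoʳ-≤ 2 (subst
        (λ b → oppositeDegree G s b u ≤ crossDegree (square G) s v) (sym (same (s u) (s v) e))
        (oppositeDegree-neighbour Guv)))
    where
    same : ∀ a b → (a xor true) xor (b xor false) ≡ true → a ≡ b
    same true  true  _ = refl
    same false false _ = refl
  ... | no _   | no lu  = ≤-trans (low⇒oppositeDegree u lu) (*-monoʳ-≤ 2 (subst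
        (λ b → oppositeDegree G s b u ≤ crossDegree (square G) s v) (opposite (s u) (s v) e)
        (oppositeDegree-neighbour Guv)))
    where
    opposite : ∀ a b → (a xor false) xor (b xor false) ≡ true → b ≡ not a
    opposite true  false _ = refl
    opposite false true  _ = refl

  switched-bound : l ≤ removedEdges G (uncut G switched) →
    l * l * l ≤ (2 * removedEdges (square G) (uncut (square G) s))
              * (2 * removedEdges (square G) (uncut (square G) s))
  switched-bound l≤cut = cube-bound {a = sum α} {b = sum β} {μ = μ} l≤ab weights
    where
    μ = removedEdges (square G) (uncut (square G) s)
    good? : ∀ u → Dec (Good u)
    good? u = l ≤? 2 * crossDegree (square G) s u
    -- Indicators of the good vertices on the two sides of `switched`; their sums are the `a` and
    -- `b` of `cube-bound`.
    α β : Fin n → ℕ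
    α u = 𝟙 (switched u ∧ ⌊ good? u ⌋)
    β u = 𝟙 (not (switched u) ∧ ⌊ good? u ⌋)
    product-sum : ∀ (f g : Fin n → ℕ) → sum (λ u → sum λ v → f u * g v) ≡ sum f * sum g
    product-sum f g = trans (sum-cong-≗ λ u → sym (*-distribˡ-sum (f u) g))
                            (sym (*-distribʳ-sum (sum g) f))
    pair : ∀ a b → 𝟙 (a xor b) ≤ 𝟙 (a ∧ true) * 𝟙 (not b ∧ true) + 𝟙 (not a ∧ true) * 𝟙 (b ∧ true)
    pair true  true  = z≤n
    pair true  false = ≤-refl
    pair false true  = ≤-refl
    pair false false = z≤n
    -- Both ends of an edge across `switched` are good, by `switched-edge⇒good` in its two
    -- orientations; the two products stand for the two ways in which the ends can lie on the new
    -- sides.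
    edge : ∀ u v → 𝟙 (cross G switched u v) ≤ α u * β v + β u * α v
    edge u v with cross G switched u v in e
    ... | false = z≤n
    ... | true with Guv , x ← ∧-true⁻ {G u v} e
      rewrite ⌊⌋-true (good? v) (switched-edge⇒good Guv x)
            | ⌊⌋-true (good? u) (switched-edge⇒good
                (trans (IsSimpleGraph.symmetric simple v u) Guv)
                (trans (Bool.xor-comm (switched v) (switched u)) x)) =
      ≤-trans (≤-reflexive (cong 𝟙 (sym x))) (pair (switched u) (switched v))
    l≤ab : l ≤ sum α * sum β
    l≤ab = *-cancelˡ-≤ 2 (begin
      2 * l                                         ≤⟨ *-monoʳ-≤ 2 l≤cut ⟩
      2 * removedEdges G (uncut G switched)         ≡⟨ arcs-cross simple switched ⟨
      arcs (cross G switched)                       ≤⟨ sum-mono-≤ (λ u → sum-mono-≤ (edge u)) ⟩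
      sum (λ u → sum λ v → α u * β v + β u * α v)   ≡⟨ sum-cong-≗ (λ u → ∑-distrib-+ (λ v → α u * β v) (λ v → β u * α v)) ⟩
      sum (λ u → sum (λ v → α u * β v) + sum (λ v → β u * α v))
        ≡⟨ ∑-distrib-+ (λ u → sum λ v → α u * β v) (λ u → sum λ v → β u * α v) ⟩
      sum (λ u → sum λ v → α u * β v) + sum (λ u → sum λ v → β u * α v)
        ≡⟨ cong₂ _+_ (product-sum α β) (trans (product-sum β α) (*-comm (sum β) (sum α))) ⟩
      sum α * sum β + sum α * sum β                 ≡⟨ 2*-+ (sum α * sum β) ⟨
      2 * (sum α * sum β)                           ∎)
      where open ≤-Reasoning
    -- A vertex lies on only one new side, so `α u + β u` is 1 if `u` is good and 0 otherwise.
    weight : ∀ u → (α u + β u) * l ≤ 2 * crossDegree (square G) s u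
    weight u with good? u | switched u
    ... | no _  | true  = z≤n
    ... | no _  | false = z≤n
    ... | yes g | true  = ≤-trans (≤-reflexive (*-identityˡ l)) g
    ... | yes g | false = ≤-trans (≤-reflexive (*-identityˡ l)) g
    weights : (sum α + sum β) * l ≤ 4 * μ
    weights = begin
      (sum α + sum β) * l                                ≡⟨ cong (_* l) (∑-distrib-+ α β) ⟨
      sum (λ u → α u + β u) * l                          ≡⟨ *-distribʳ-sum l (λ u → α u + β u) ⟩
      sum (λ u → (α u + β u) * l)                        ≤⟨ sum-mono-≤ weight ⟩
      sum (λ u → 2 * crossDegree (square G) s u)         ≡⟨ *-distribˡ-sum 2 (crossDegree (square G) s) ⟨
      -- The sum of the cross degrees unfolds to `arcs`, where each cut edge is counted at both
      -- ends.
      2 * arcs (cross (square G) s)                      ≡⟨ cong (2 *_) (arcs-cross (square-simple simple) s) ⟩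
      2 * (2 * μ)                                        ≡⟨ *-assoc 2 2 μ ⟨
      4 * μ                                              ∎
      where open ≤-Reasoning

  -- For positive `l` a vertex given by `vertexOffCut` is low and keeps its side, so both values of
  -- `s` survive; for `l = 0` every vertex would be high.
  switched-nonconstant : 1 ≤ l → Nonconstant s →
    (∀ v → removedEdges (square G) (uncut (square G) s) < degree (square G) v) →
    Nonconstant switched
  switched-nonconstant 1≤l (onTrue , onFalse) deg = unswitched onTrue , unswitched onFalse
    where
    unswitched : ∀ {b} → ∃ (λ x → s x ≡ b) → ∃ λ x → switched x ≡ b
    unswitched x₀ with x , refl , c≡0 ← vertexOffCut (square-simple simple) s deg x₀ =
      x , trans (cong (s x xor_) (⌊⌋-false (high? x) low)) (Bool.xor-identityʳ (s x))
      where
      low : ¬ High x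
      low high = <⇒≱ 1≤l (≤-trans high (*-monoʳ-≤ 2
        (≤-trans (crossDegree-square x) (≤-reflexive c≡0))))

-- Minimum cut against minimum degree

-- The real inequality `μ ≥ (l^(3/2) - l) / 2` is stated without roots: moving `l` to the other side
-- makes both sides nonnegative, and squaring gives the form used here.
theorem4 : (l n : ℕ) (G : Adjacency (suc n)) → IsSimpleGraph G → Connected G →
    EdgeConnected l G →
    MaximallyEdgeConnected (square G)
    ⊎ Σ ℕ (λ μ → IsEdgeConnectivity (square G) μ
    × l * l * l ≤ (2 * μ + l) * (2 * μ + l))
-- On a single vertex the minimum degree and, by convention, the edge-connectivity are both 0.
theorem4 l zero G simple conn lconn =
  inj₁ (0 , ((λ _ _ ()) , (λ { (s≤s ()) }) , λ _ → refl) , (λ _ → z≤n) , zero , refl)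
theorem4 l (suc n) G simple conn lconn =
  conclude (minimumCut simple² (singleton-nonconstant zero))
  where
  H = square G
  simple² = square-simple simple
  cutSize : (Fin (suc (suc n)) → Bool) → ℕ
  cutSize s = removedEdges H (uncut H s)
  conclude : ∃[ s ] Nonconstant s × (∀ t → Nonconstant t → cutSize s ≤ cutSize t) →
    MaximallyEdgeConnected H
    ⊎ Σ ℕ (λ μ → IsEdgeConnectivity H μ × l * l * l ≤ (2 * μ + l) * (2 * μ + l))
  -- Singleton cuts show that no degree is below the minimum cut. Either some degree attains it, or
  -- all degrees exceed it and switching applies.
  conclude (s , nonconst , minimal) with any? (λ v → degree H v ≤? cutSize s)
  ... | yes (v , deg≤μ) =
    inj₁ (cutSize s , connectivity , μ≤degree , v , ≤-antisym deg≤μ (μ≤degree v))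
    where
    connectivity = edgeConnectivity simple² (s≤s (s≤s z≤n)) nonconst minimal
    μ≤degree : ∀ v → cutSize s ≤ degree H v
    μ≤degree v = ≤-trans (minimal _ (singleton-nonconstant v))
                         (≤-reflexive (removedEdges-singleton simple² v))
  ... | no none = inj₂ (cutSize s ,
    edgeConnectivity simple² (s≤s (s≤s z≤n)) nonconst minimal , bound l lconn)
    where
    bound : ∀ l → EdgeConnected l G → l * l * l ≤ (2 * cutSize s + l) * (2 * cutSize s + l)
    -- The case `l = 0` is split off because `switched-nonconstant` requires a positive `l`.
    bound zero    _     = z≤n
    bound (suc k) lconn = ≤-trans
      (switched-bound simple (suc k) l≤degree s (edgeConnected⇒cut simple lconn
        (switched-nonconstant simple (suc k) l≤degree s (s≤s z≤n) nonconst
          λ v → ≰⇒> λ deg≤μ → none (v , deg≤μ))))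
      -- Switching yields `l³ ≤ (2μ)²`, which is weakened here to the stated form.
      (*-mono-≤ {2 * cutSize s} {2 * cutSize s + suc k} (m≤m+n _ (suc k)) (m≤m+n _ (suc k)))
      where
      l≤degree : ∀ v → suc k ≤ degree G v
      l≤degree v = ≤-trans (edgeConnected⇒cut simple lconn (singleton-nonconstant v))
                           (≤-reflexive (removedEdges-singleton simple v))
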